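{- Let $(X,\mathcal{R})$ be an association scheme with $d$ classes, adjacency matrices $A_0,\ldots,A_d$ and intersection numbers $p_{i,j}^k$, and let $F\subset\{1,2,\ldots,d\}$. Let $D$ be the directed graph with adjacency matrix $\sum_{f\in F}A_f$. Then $D$ is a directed Deza graph if and only if $$\sum_{f,g\in F}p_{f,g}^k$$ takes on at most two values as $k$ ranges over $\{1,\ldots,d\}$.
   Context: Association scheme: let $X$ be a finite set of size $n$ and $\mathcal{R}=\{R_0,\ldots,R_d\}$ relations on $X$, and let $A_i$ be the $(0,1)$-matrix with $[A_i]_{xy}=1$ iff $(x,y)\in R_i$. The pair $(X,\mathcal{R})$ is an association scheme with $d$ classes if: (1) $A_0=I$; (2) $\sum_{i=0}^dA_i=J$ (the all-ones matrix); (3) $A_i^t\in\{A_0,\ldots,A_d\}$ for all $i$; (4) for all $i,j,k\in\{0,\ldots,d\}$ there are non-negative integers $p_{i,j}^k$ with $A_iA_j=\sum_{k=0}^dp_{i,j}^kA_k$; (5) $A_iA_j=A_jA_i$ for all $i,j$. The scheme is not assumed symmetric. Digraphs have no loops and at most one arc from one vertex to another. Write $u\rightarrow v$ if there is an arc from $u$ to $v$. Two vertices $u,v$ are called adjacent if $u\rightarrow v$ and $v\rightarrow u$. The adjacency matrix of a digraph has $(i,j)$-entry $1$ iff $i\rightarrow j$, and $0$ otherwise. Let $n,k,b,a,t$ be integers with $0\le a\le b\le k\le n$ and $0\le t\le k$. A digraph $D=(V,A)$ is a directed $(n,k,b,a,t)$-Deza graph if: (1) $|V|=n$; (2) every vertex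 has in-degree and out-degree $k$ and is adjacent to exactly $t$ vertices; (3) for any distinct vertices $u,v$, the number of vertices $w$ with $u\rightarrow w\rightarrow v$ is $a$ or $b$. A directed Deza graph is a directed $(n,k,b,a,t)$-Deza graph for some such parameters. -}

module Defs where

open import Algebra.Properties.Semiring.Sum
open import Data.Bool.Base using (if_then_else_)
open import Data.Fin.Base using (Fin; zero; suc)
open import Data.Fin.Properties using (_≟_)
open import Data.Fin.Subset using (Subset)
open import Data.Fin.Subset.Properties using (_∈?_)
open import Data.List.Base using (length; filter; allFin)
open import Data.Nat.Base using (ℕ; suc; _*_; _≤_)
open import Data.Nat.Properties using (+-*-semiring)
open import Data.Product.Base using (∃; ∃₂; _×_)
open import Data.Sum.Base using (_⊎_)
open import Level using (0ℓ)
open import Relation.Binary.Core using (Rel)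
open import Relation.Binary.Definitions using (Decidable)
open import Relation.Binary.PropositionalEquality.Core using (_≡_; _≢_)
open import Relation.Nullary.Decidable.Core using (does; _×-dec_)
open import Relation.Nullary.Negation.Core using (¬_)
import Relation.Unary as U

∑ : ∀ {m} → (Fin m → ℕ) → ℕ
∑ = sum +-*-semiring

∑∈ : ∀ {m} → Subset m → (Fin m → ℕ) → ℕ
∑∈ F g = ∑ λ i → if does (i ∈? F) then g i else 0

# : ∀ {n} {P : Fin n → Set} → U.Decidable P → ℕ
# {n} P? = length (filter P? (allFin n))

Matrix : ℕ → Set
Matrix n = Fin n → Fin n → ℕ

infix 4 _≋_
_≋_ : ∀ {n} → Matrix n → Matrix n → Set
M ≋ N = ∀ x y → M x y ≡ N x y

infixl 7 _·_
_·_ : ∀ {n} → Matrix n → Matrix n → Matrix n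
(M · N) x y = ∑ λ z → M x z * N z y

infix 8 _ᵗ
_ᵗ : ∀ {n} → Matrix n → Matrix n
(M ᵗ) x y = M y x

relMatrix : ∀ {n} {R : Rel (Fin n) 0ℓ} → Decidable R → Matrix n
relMatrix R? x y = if does (R? x y) then 1 else 0

𝕀 𝕁 : ∀ {n} → Matrix n
𝕀     = relMatrix _≟_
𝕁 x y = 1

record AssociationScheme (n d : ℕ) : Set₁ where
  field
    R  : Fin (suc d) → Rel (Fin n) 0ℓ
    R? : ∀ i → Decidable (R i)

  A : Fin (suc d) → Matrix n
  A i = relMatrix (R? i)

  field
    -- If R k were empty then A k = 0, and the numbers p i j k would not be
    -- determined by the product rule.  (R zero is the diagonal.)
    nonempty  : ∀ (k : Fin d) → ∃₂ (R (suc k))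
    identity  : A zero ≋ 𝕀
    partition : (λ x y → ∑ λ i → A i x y) ≋ 𝕁
    transpose : ∀ i → ∃ λ j → A i ᵗ ≋ A j
    -- p i j k is the intersection number with lower indices i, j and
    -- upper index k.
    p         : (i j k : Fin (suc d)) → ℕ
    product   : ∀ i j → A i · A j ≋ λ x y → ∑ λ k → p i j k * A k x y
    commute   : ∀ i j → A i · A j ≋ A j · A i

record Digraph (n : ℕ) : Set₁ where
  infix 4 _⟶_ _⟶?_
  field
    _⟶_      : Rel (Fin n) 0ℓ
    _⟶?_     : Decidable _⟶_
    loopless : ∀ u → ¬ (u ⟶ u)

  Adjacent : Rel (Fin n) 0ℓ
  Adjacent u v = (u ⟶ v) × (v ⟶ u)

  adjacent? : Decidable Adjacent
  adjacent? u v = (u ⟶? v) ×-dec (v ⟶? u)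

  adjacencyMatrix : Matrix n
  adjacencyMatrix = relMatrix _⟶?_

  outDegree inDegree adjacentCount : Fin n → ℕ
  outDegree     u = # λ v → u ⟶? v
  inDegree      u = # λ v → v ⟶? u
  adjacentCount u = # λ v → adjacent? u v

  pathCount : Fin n → Fin n → ℕ
  pathCount u v = # λ w → (u ⟶? w) ×-dec (w ⟶? v)

record IsDirectedDezaGraph (n k b a t : ℕ) (D : Digraph n) : Set where
  open Digraph D
  field
    a≤b         : a ≤ b
    b≤k         : b ≤ k
    k≤n         : k ≤ n
    t≤k         : t ≤ k
    in-regular  : ∀ u → inDegree u ≡ k
    out-regular : ∀ u → outDegree u ≡ k
    adjacent-t  : ∀ u → adjacentCount u ≡ t
    paths       : ∀ u v → u ≢ v → (pathCount u v ≡ a) ⊎ (pathCount u v ≡ b)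

DirectedDeza : ∀ {n} → Digraph n → Set
DirectedDeza {n} D =
  ∃₂ λ k b → ∃₂ λ a t → IsDirectedDezaGraph n k b a t D

AtMostTwoValues : ∀ {m} → (Fin m → ℕ) → Set
AtMostTwoValues f = ∃₂ λ α β → ∀ i → (f i ≡ α) ⊎ (f i ≡ β)

{-# OPTIONS --safe #-}
-- Let M be the adjacency matrix of D.  If (x,y) ∈ R k, then the (x,y) entry of
-- A i A j is p i j k, so the number of paths x → w → y, which is the (x,y) entry
-- of M², is the sum of p f g k over f, g ∈ F.  The case k = 0 shows that the
-- number of vertices adjacent to x does not depend on x.  Since J = ∑ⱼ Aⱼ, the
-- row sum of A f at x is the (x,x) entry of ∑ⱼ A f Aⱼ, which is ∑ⱼ p f j 0, and
-- by commutativity this is also the column sum.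
module Submission where

open import Defs
open import Data.Nat.Properties hiding (_≟_)
open import Algebra.Properties.Semiring.Sum +-*-semiring
  using (sum-replicate-zero; ∑-comm; *-distribˡ-sum; *-distribʳ-sum; sum-remove)
  renaming (sum-cong-≗ to ∑-cong)
open import Data.Bool.Base using (Bool; true; false; if_then_else_)
open import Data.Bool.Properties using (if-float; if-cong-else)
open import Data.Fin.Base using (Fin; zero; suc; toℕ; punchIn)
open import Data.Fin.Properties using (_≟_; any?; toℕ-injective)
open import Data.Fin.Subset using (Subset; _∉_)
open import Data.Fin.Subset.Properties using (_∈?_)
open import Data.List.Base using (length; filter; tabulate; allFin)
open import Data.List.Properties using (length-filter; length-tabulate)
open import Data.List.Relation.Binary.Sublist.Propositional using (⊆-refl)
open import Data.List.Relation.Binary.Sublist.Propositional.Properties using (filter⁺; length-mono-≤)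
open import Data.Nat.Base using (ℕ; zero; suc; _+_; _*_; _≤_; _⊓_; _⊔_; z≤n)
open import Data.Product.Base using (∃; _,_; proj₁)
open import Data.Sum.Base using (_⊎_; inj₁; inj₂; swap)
import Data.Sum.Base as Sum
open import Function.Base using (_∘_)
open import Function.Bundles using (_⇔_; mk⇔)
open import Relation.Binary.PropositionalEquality
open import Relation.Nullary using (Dec; yes; no; does; ¬_; contradiction; _×-dec_)
open import Relation.Nullary.Decidable using (dec-true; dec-false)
import Relation.Unary as U

private
  variable
    m n : ℕ

-- Indicators, finite sums and counting.

indicator : ∀ {P : Set} → Dec P → ℕ
indicator P? = if does P? then 1 else 0

indicator-yes : ∀ {P : Set} (P? : Dec P) → P → indicator P? ≡ 1
indicator-yes P? p rewrite dec-true P? p = refl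

indicator-no : ∀ {P : Set} (P? : Dec P) → ¬ P → indicator P? ≡ 0
indicator-no P? ¬p rewrite dec-false P? ¬p = refl

indicator-yes⁻¹ : ∀ {P : Set} (P? : Dec P) → indicator P? ≡ 1 → P
indicator-yes⁻¹ (yes p) _ = p

indicator-× : ∀ {P Q : Set} (P? : Dec P) (Q? : Dec Q) →
  indicator (P? ×-dec Q?) ≡ indicator P? * indicator Q?
indicator-× P? Q? with does P? | does Q?
... | true  | true  = refl
... | true  | false = refl
... | false | _     = refl

∑≡0⇒≗0 : {f : Fin m → ℕ} → ∑ f ≡ 0 → ∀ i → f i ≡ 0
∑≡0⇒≗0 {f = f} eq zero    = m+n≡0⇒m≡0 (f zero) eq
∑≡0⇒≗0 {f = f} eq (suc i) = ∑≡0⇒≗0 (m+n≡0⇒n≡0 (f zero) eq) i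

≗0⇒∑≡0 : {f : Fin m → ℕ} → (∀ i → f i ≡ 0) → ∑ f ≡ 0
≗0⇒∑≡0 {m} f≗0 = trans (∑-cong f≗0) (sum-replicate-zero m)

-- Natural numbers with sum 1, one of which is already 1, leave 0 for all the others, so only the
-- term at `k` survives the weighting by `g`.
∑-select : (f g : Fin m → ℕ) → ∑ f ≡ 1 → ∀ k → f k ≡ 1 → ∑ (λ i → g i * f i) ≡ g k
∑-select {suc m} f g ∑f≡1 k fk≡1 = begin
  ∑ (λ i → g i * f i)
    ≡⟨ sum-remove {i = k} (λ i → g i * f i) ⟩
  g k * f k + ∑ (λ i → g (punchIn k i) * f (punchIn k i))
    ≡⟨ cong₂ _+_ (trans (cong (g k *_) fk≡1) (*-identityʳ (g k))) (≗0⇒∑≡0 others) ⟩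
  g k + 0
    ≡⟨ +-identityʳ (g k) ⟩
  g k ∎
  where
  open ≡-Reasoning
  ∑others≡0 : ∑ (f ∘ punchIn k) ≡ 0
  ∑others≡0 = suc-injective (trans (cong (_+ ∑ (f ∘ punchIn k)) (sym fk≡1))
    (trans (sym (sum-remove {i = k} f)) ∑f≡1))
  others : ∀ i → g (punchIn k i) * f (punchIn k i) ≡ 0
  others i = trans (cong (g (punchIn k i) *_) (∑≡0⇒≗0 {f = f ∘ punchIn k} ∑others≡0 i)) (*-zeroʳ (g (punchIn k i)))

∑∈-cong : (F : Subset m) {f g : Fin m → ℕ} → f ≗ g → ∑∈ F f ≡ ∑∈ F g
∑∈-cong F f≗g = ∑-cong λ i → cong (λ z → if does (i ∈? F) then z else 0) (f≗g i)

#≡∑ : {P : Fin n → Set} (P? : U.Decidable P) → # P? ≡ ∑ (λ i → indicator (P? i))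
#≡∑ P? = go P? (λ i → i)
  where
  -- The induction runs over an arbitrary `f`, because the tail of `tabulate f` is
  -- `tabulate (f ∘ suc)`.
  go : ∀ {m n} {P : Fin n → Set} (P? : U.Decidable P) (f : Fin m → Fin n) →
    length (filter P? (tabulate f)) ≡ ∑ (λ i → indicator (P? (f i)))
  go {zero}  P? f = refl
  go {suc m} P? f with does (P? (f zero))
  ... | true  = cong suc (go P? (f ∘ suc))
  ... | false = go P? (f ∘ suc)

#-mono-≤ : {P Q : Fin n → Set} (P? : U.Decidable P) (Q? : U.Decidable Q) →
  (∀ {i} → P i → Q i) → # P? ≤ # Q?
#-mono-≤ {n} P? Q? P⊆Q = length-mono-≤ (filter⁺ P? Q? (λ { refl → P⊆Q }) (⊆-refl {x = allFin n}))

#≤n : {P : Fin n → Set} (P? : U.Decidable P) → # P? ≤ n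
#≤n {n} P? = subst (# P? ≤_) (length-tabulate {n = n} (λ i → i)) (length-filter P? (allFin n))

-- Matrix products and sums of matrices.

·-cong : {M M′ N N′ : Matrix n} → M ≋ M′ → N ≋ N′ → M · N ≋ M′ · N′
·-cong M≋M′ N≋N′ x y = ∑-cong λ z → cong₂ _*_ (M≋M′ x z) (N≋N′ z y)

·-distribʳ-∑ : (B : Fin m → Matrix n) (C : Matrix n) →
  (λ x y → ∑ λ i → B i x y) · C ≋ λ x y → ∑ λ i → (B i · C) x y
·-distribʳ-∑ B C x y = trans
  (∑-cong λ z → *-distribʳ-sum (C z y) (λ i → B i x z))
  (∑-comm (λ z i → B i x z * C z y))

·-distribˡ-∑ : (B : Matrix n) (C : Fin m → Matrix n) →
  B · (λ x y → ∑ λ i → C i x y) ≋ λ x y → ∑ λ i → (B · C i) x y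
·-distribˡ-∑ B C x y = trans
  (∑-cong λ z → *-distribˡ-sum (B x z) (λ i → C i z y))
  (∑-comm (λ z i → B x z * C i z y))

∑-if : (b : Bool) (f : Fin m → ℕ) →
  ∑ (λ i → if b then f i else 0) ≡ (if b then ∑ f else 0)
∑-if true  f = refl
∑-if {m} false f = sum-replicate-zero m

∑-∑∈-comm : (F : Subset m) (f : Fin n → Fin m → ℕ) →
  ∑ (λ z → ∑∈ F (f z)) ≡ ∑∈ F (λ i → ∑ λ z → f z i)
∑-∑∈-comm F f = trans
  (∑-comm (λ z i → if does (i ∈? F) then f z i else 0))
  (∑-cong λ i → ∑-if (does (i ∈? F)) (λ z → f z i))

·-distribʳ-∑∈ : (F : Subset m) (B : Fin m → Matrix n) (C : Matrix n) →
  (λ x y → ∑∈ F λ i → B i x y) · C ≋ λ x y → ∑∈ F λ i → (B i · C) x y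
·-distribʳ-∑∈ F B C x y = trans
  (∑-cong λ z → trans
    (*-distribʳ-sum (C z y) (λ i → if does (i ∈? F) then B i x z else 0))
    (∑-cong λ i → if-float (_* C z y) (does (i ∈? F))))
  (∑-∑∈-comm F (λ z i → B i x z * C z y))

·-distribˡ-∑∈ : (F : Subset m) (B : Matrix n) (C : Fin m → Matrix n) →
  B · (λ x y → ∑∈ F λ i → C i x y) ≋ λ x y → ∑∈ F λ i → (B · C i) x y
·-distribˡ-∑∈ F B C x y = trans
  (∑-cong λ z → trans
    (*-distribˡ-sum (B x z) (λ i → if does (i ∈? F) then C i z y else 0))
    (∑-cong λ i → trans
      (if-float (B x z *_) (does (i ∈? F)))
      -- Unlike `0 * C z y` in the mirrored lemma, `B x z * 0` does not compute to 0.
      (if-cong-else (does (i ∈? F)) (*-zeroʳ (B x z)))))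
  (∑-∑∈-comm F (λ z i → B x z * C i z y))

-- Relations, intersection numbers and valencies of a scheme.

module _ {n d : ℕ} (S : AssociationScheme n d) where
  open AssociationScheme S

  -- If no relation held, every `A i x y` would be 0, while `partition` makes their sum 1.
  related : ∀ x y → ∃ λ k → R k x y
  related x y with any? (λ k → R? k x y)
  ... | yes k∈ = k∈
  ... | no ∄k  = contradiction
    (trans (sym (≗0⇒∑≡0 λ k → indicator-no (R? k x y) λ r → ∄k (k , r))) (partition x y))
    0≢1+n

  A-select : ∀ {k x y} (g : Fin (suc d) → ℕ) → R k x y → ∑ (λ i → g i * A i x y) ≡ g k
  A-select {k} {x} {y} g r =
    ∑-select (λ i → A i x y) g (partition x y) k (indicator-yes (R? k x y) r)

  -- With `toℕ` as weight, the sum in `A-select` returns the index of any relation that holds at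
  -- `(x , y)`, and this sum does not depend on which one was chosen.
  R-unique : ∀ {i j x y} → R i x y → R j x y → i ≡ j
  R-unique r s = toℕ-injective (trans (sym (A-select toℕ r)) (A-select toℕ s))

  R-refl : ∀ x → R zero x x
  R-refl x = indicator-yes⁻¹ (R? zero x x) (trans (identity x x) (indicator-yes (x ≟ x) refl))

  R-zero⇒≡ : ∀ {x y} → R zero x y → x ≡ y
  R-zero⇒≡ {x} {y} r = indicator-yes⁻¹ (x ≟ y)
    (trans (sym (identity x y)) (indicator-yes (R? zero x y) r))

  R-suc⇒≢ : ∀ {k x y} → R (suc k) x y → x ≢ y
  R-suc⇒≢ {x = x} r refl with () ← R-unique r (R-refl x)

  A·A≡p : ∀ {k x y} i j → R k x y → (A i · A j) x y ≡ p i j k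
  A·A≡p {x = x} {y} i j r = trans (product i j x y) (A-select (p i j) r)

  -- Usually written `p i i′ zero`, where `A i′` is the transpose of `A i`. If there is a vertex,
  -- the other terms vanish, so summing over all `j` avoids singling out `i′`.
  valency : Fin (suc d) → ℕ
  valency i = ∑ λ j → p i j zero

  row-sum : ∀ i x → ∑ (λ z → A i x z) ≡ valency i
  row-sum i x = begin
    -- The inserted factor 1 is an entry of `𝕁`, which turns the row sum into a diagonal entry of a
    -- product.
    ∑ (λ z → A i x z)                  ≡⟨ ∑-cong (λ z → sym (*-identityʳ (A i x z))) ⟩
    (A i · 𝕁) x x                      ≡⟨ ·-cong {M = A i} (λ _ _ → refl) (λ z w → sym (partition z w)) x x ⟩
    (A i · (λ z w → ∑ λ j → A j z w)) x x
                                       ≡⟨ ·-distribˡ-∑ (A i) A x x ⟩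
    ∑ (λ j → (A i · A j) x x)          ≡⟨ ∑-cong (λ j → A·A≡p i j (R-refl x)) ⟩
    valency i                          ∎
    where open ≡-Reasoning

  column-sum : ∀ i x → ∑ (λ z → A i z x) ≡ valency i
  column-sum i x = begin
    ∑ (λ z → A i z x)                  ≡⟨ ∑-cong (λ z → sym (*-identityˡ (A i z x))) ⟩
    (𝕁 · A i) x x                      ≡⟨ ·-cong {N = A i} (λ z w → sym (partition z w)) (λ _ _ → refl) x x ⟩
    ((λ z w → ∑ λ j → A j z w) · A i) x x
                                       ≡⟨ ·-distribʳ-∑ A (A i) x x ⟩
    ∑ (λ j → (A j · A i) x x)          ≡⟨ ∑-cong (λ j → commute j i x x) ⟩
    ∑ (λ j → (A i · A j) x x)          ≡⟨ ∑-cong (λ j → A·A≡p i j (R-refl x)) ⟩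
    valency i                          ∎
    where open ≡-Reasoning

  -- Degrees and path counts of the digraph.

  module _ (F : Subset (suc d)) where

    pathValue : Fin (suc d) → ℕ
    pathValue k = ∑∈ F λ f → ∑∈ F λ g → p f g k

    degree : ℕ
    degree = ∑∈ F valency

  module _ (F : Subset (suc d)) (D : Digraph n)
           (adjacency : Digraph.adjacencyMatrix D ≋ λ x y → ∑∈ F λ f → A f x y) where
    open Digraph D

    outDegree≡degree : ∀ u → outDegree u ≡ degree F
    outDegree≡degree u = begin
      outDegree u                          ≡⟨ #≡∑ (λ v → u ⟶? v) ⟩
      ∑ (λ v → adjacencyMatrix u v)        ≡⟨ ∑-cong (λ v → adjacency u v) ⟩
      ∑ (λ v → ∑∈ F λ f → A f u v)         ≡⟨ ∑-∑∈-comm F (λ v f → A f u v) ⟩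
      ∑∈ F (λ f → ∑ λ v → A f u v)         ≡⟨ ∑∈-cong F (λ f → row-sum f u) ⟩
      degree F                             ∎
      where open ≡-Reasoning

    inDegree≡degree : ∀ u → inDegree u ≡ degree F
    inDegree≡degree u = begin
      inDegree u                           ≡⟨ #≡∑ (λ v → v ⟶? u) ⟩
      ∑ (λ v → adjacencyMatrix v u)        ≡⟨ ∑-cong (λ v → adjacency v u) ⟩
      ∑ (λ v → ∑∈ F λ f → A f v u)         ≡⟨ ∑-∑∈-comm F (λ v f → A f v u) ⟩
      ∑∈ F (λ f → ∑ λ v → A f v u)         ≡⟨ ∑∈-cong F (λ f → column-sum f u) ⟩
      degree F                             ∎
      where open ≡-Reasoning

    pathCount≡pathValue : ∀ {k u v} → R k u v → pathCount u v ≡ pathValue F k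
    pathCount≡pathValue {k} {u} {v} r = begin
      pathCount u v
        ≡⟨ #≡∑ (λ w → (u ⟶? w) ×-dec (w ⟶? v)) ⟩
      ∑ (λ w → indicator ((u ⟶? w) ×-dec (w ⟶? v)))
        ≡⟨ ∑-cong (λ w → indicator-× (u ⟶? w) (w ⟶? v)) ⟩
      (adjacencyMatrix · adjacencyMatrix) u v
        ≡⟨ ·-cong adjacency adjacency u v ⟩
      (M · M) u v
        ≡⟨ ·-distribʳ-∑∈ F A M u v ⟩
      ∑∈ F (λ f → (A f · M) u v)
        ≡⟨ ∑∈-cong F (λ f → ·-distribˡ-∑∈ F (A f) A u v) ⟩
      ∑∈ F (λ f → ∑∈ F λ g → (A f · A g) u v)
        ≡⟨ ∑∈-cong F (λ f → ∑∈-cong F λ g → A·A≡p f g r) ⟩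
      pathValue F k ∎
      where
      open ≡-Reasoning
      M : Matrix n
      M x y = ∑∈ F λ f → A f x y

    -- The midpoint of a path is an out-neighbour of `u`. The bound justifies truncating the path
    -- values at the degree and, for `u` equal to `v`, bounds the number of adjacent vertices.
    pathCount≤degree : ∀ u v → pathCount u v ≤ degree F
    pathCount≤degree u v = subst (pathCount u v ≤_) (outDegree≡degree u)
      (#-mono-≤ (λ w → (u ⟶? w) ×-dec (w ⟶? v)) (λ w → u ⟶? w) proj₁)

    -- Each nonzero class contains a pair of vertices, necessarily distinct, and the path count of
    -- that pair is the value at `k`.
    Deza⇒two-values : DirectedDeza D → AtMostTwoValues (pathValue F ∘ suc)
    Deza⇒two-values (_ , b , a , _ , deza) = a , b , λ k →
      let x , y , r = nonempty k in
      Sum.map (trans (sym (pathCount≡pathValue r))) (trans (sym (pathCount≡pathValue r)))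
        (IsDirectedDezaGraph.paths deza x y (R-suc⇒≢ r))

    pathCount-values : ∀ {α β} → (∀ k → (pathValue F (suc k) ≡ α) ⊎ (pathValue F (suc k) ≡ β)) →
      ∀ u v → u ≢ v → (pathCount u v ≡ α) ⊎ (pathCount u v ≡ β)
    pathCount-values h u v u≢v with related u v
    ... | zero  , r = contradiction (R-zero⇒≡ r) u≢v
    ... | suc k , r =
      Sum.map (trans (pathCount≡pathValue r)) (trans (pathCount≡pathValue r)) (h k)

-- Choice of the Deza parameters.

⊎-⊓-⊔ : ∀ {c} α β → (c ≡ α) ⊎ (c ≡ β) → (c ≡ α ⊓ β) ⊎ (c ≡ α ⊔ β)
⊎-⊓-⊔ α β h with ≤-total α β
... | inj₁ α≤β rewrite m≤n⇒m⊓n≡m α≤β | m≤n⇒m⊔n≡n α≤β = h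
... | inj₂ β≤α rewrite m≥n⇒m⊓n≡n β≤α | m≥n⇒m⊔n≡m β≤α = swap h

-- An attained value is at most `k` already, so truncation leaves it unchanged.
⊓-bounded : ∀ {c α k} → c ≤ k → c ≡ α → c ≡ α ⊓ k
⊓-bounded c≤k refl = sym (m≤n⇒m⊓n≡m c≤k)

-- One of the two values α and β need not be attained and may exceed the degree,
-- hence the truncation.  With no vertices the intersection numbers are arbitrary,
-- so the degree computed from them is useless.
two-values⇒Deza : ∀ {n d} (S : AssociationScheme n d) (let open AssociationScheme S)
  (F : Subset (suc d)) (D : Digraph n)
  (adjacency : Digraph.adjacencyMatrix D ≋ λ x y → ∑∈ F λ f → A f x y) →
  AtMostTwoValues (pathValue S F ∘ suc) → DirectedDeza D
two-values⇒Deza {zero} S F D adjacency _ = 0 , 0 , 0 , 0 , record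
  { a≤b         = z≤n
  ; b≤k         = z≤n
  ; k≤n         = z≤n
  ; t≤k         = z≤n
  ; in-regular  = λ ()
  ; out-regular = λ ()
  ; adjacent-t  = λ ()
  ; paths       = λ ()
  }
two-values⇒Deza {suc n} S F D adjacency (α , β , values) = k , a ⊔ b , a ⊓ b , t , record
  { a≤b         = m⊓n≤m⊔n a b
  ; b≤k         = ⊔-lub (m⊓n≤n α k) (m⊓n≤n β k)
  -- Vertex `zero` exists in this case; its counts supply the bounds on `k` and `t`.
  ; k≤n         = subst (_≤ suc n) (outDegree≡degree S F D adjacency zero) (#≤n (zero ⟶?_))
  ; t≤k         = subst (_≤ k) (adjacent zero) (pathCount≤degree S F D adjacency zero zero)
  ; in-regular  = inDegree≡degree S F D adjacency
  ; out-regular = outDegree≡degree S F D adjacency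
  ; adjacent-t  = adjacent
  ; paths       = λ u v u≢v → let c≤k = pathCount≤degree S F D adjacency u v in
      -- The truncated values come in no particular order, whereas the Deza parameters must be
      -- ordered; hence the minimum and the maximum.
      ⊎-⊓-⊔ a b (Sum.map (⊓-bounded c≤k) (⊓-bounded c≤k)
        (pathCount-values S F D adjacency values u v u≢v))
  }
  where
  open Digraph D
  k = degree S F
  a = α ⊓ k
  b = β ⊓ k
  t = pathValue S F zero
  adjacent : ∀ u → adjacentCount u ≡ t
  -- By definition `adjacentCount u` is `pathCount u u`.
  adjacent u = pathCount≡pathValue S F D adjacency (R-refl S u)

theorem3p4 : ∀ {n d : ℕ} (S : AssociationScheme n d) (let open AssociationScheme S)
    (F : Subset (suc d)) → zero ∉ F →
    (D : Digraph n) →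
    Digraph.adjacencyMatrix D ≋ (λ x y → ∑∈ F (λ f → A f x y)) →
    DirectedDeza D ⇔ AtMostTwoValues (λ (k : Fin d) → ∑∈ F (λ f → ∑∈ F (λ g → p f g (suc k))))
theorem3p4 S F _ D adjacency = mk⇔
  (Deza⇒two-values S F D adjacency)
  (two-values⇒Deza S F D adjacency)
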